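{- For every discrete signature $\Sigma$, $\mathsf{FSAT}(\Sigma)\preceq\mathsf{FSAT}(\mathbb 0;\{P^2\})$. Here $\Sigma$ is discrete if both its type of function symbols and its type of relation symbols have decidable equality, and $(\mathbb 0;\{P^2\})$ is the signature with no function symbols and one binary relation symbol $P$.
   Context: We work in constructive type theory. $p\preceq q$ means there is a function $f$ with $p\,x\leftrightarrow q(f\,x)$ for all $x$. $\mathbb 0$ is the empty type. A type is finite if some list contains all of its elements. A signature consists of a type of function symbols and a type of relation symbols, each with an arity. Formulas are first-order formulas built from $\dot\bot$, atoms, $\dot\to,\dot\land,\dot\lor,\dot\forall,\dot\exists$. A model over a domain $D$ interprets function symbols as functions $D^{|f|}\to D$ and relation symbols as predicates $D^{|P|}\to\mathbb P$, with Tarski satisfaction $\mathcal M\vDash_\rho\varphi$. The model is decidable if every relation interpretation is decidable. $\mathsf{FSAT}(\Sigma)\,\varphi$ holds iff some finite type $D$, decidable model over $D$ and assignment $\rho$ satisfy $\varphi$. -}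

module Defs where

open import Data.Empty using (⊥)
open import Data.List using (List)
open import Data.List.Membership.Propositional using (_∈_)
open import Data.Nat using (ℕ; zero; suc)
open import Data.Product using (∃-syntax; Σ-syntax; _×_)
open import Data.Sum using (_⊎_)
open import Data.Unit using (⊤)
open import Data.Vec using (Vec; []; _∷_)
open import Function.Bundles using (_⇔_)
open import Level using (Level; _⊔_) renaming (suc to lsuc; zero to 0ℓ)
open import Relation.Binary.Definitions using (DecidableEquality)
open import Relation.Unary using (Pred; Decidable)

infix 4 _⪯_

_⪯_ : ∀ {a b p q} {X : Set a} {Y : Set b} → Pred X p → Pred Y q → Set (a ⊔ b ⊔ p ⊔ q)
_⪯_ {X = X} {Y = Y} p q = Σ[ f ∈ (X → Y) ] (∀ x → p x ⇔ q (f x))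

Finite : ∀ {a} → Set a → Set a
Finite A = Σ[ xs ∈ List A ] (∀ x → x ∈ xs)

record Signature (a b : Level) : Set (lsuc (a ⊔ b)) where
  field
    Fun   : Set a
    arᶠ   : Fun → ℕ
    Rel   : Set b
    arʳ   : Rel → ℕ

Discrete : ∀ {a b} → Signature a b → Set (a ⊔ b)
Discrete S = DecidableEquality Fun × DecidableEquality Rel
  where open Signature S

binarySignature : Signature 0ℓ 0ℓ
binarySignature = record { Fun = ⊥ ; arᶠ = λ () ; Rel = ⊤ ; arʳ = λ _ → 2 }

module _ {a b : Level} (S : Signature a b) where
  open Signature S

  -- Variables are de Bruijn indices; ∀̇ and ∃̇ bind index 0.
  data Term : Set a where
    var : ℕ → Term
    app : (f : Fun) → Vec Term (arᶠ f) → Term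

  infixr 6 _∧̇_
  infixr 5 _∨̇_
  infixr 4 _→̇_

  data Formula : Set (a ⊔ b) where
    ⊥̇             : Formula
    atom          : (P : Rel) → Vec Term (arʳ P) → Formula
    _→̇_ _∧̇_ _∨̇_   : Formula → Formula → Formula
    ∀̇_ ∃̇_         : Formula → Formula

  -- Propositions are types in Set; accordingly ∃ and ∨ are read as Σ and ⊎ throughout.
  record Model (D : Set) : Set (a ⊔ b ⊔ lsuc 0ℓ) where
    field
      fun : (f : Fun) → Vec D (arᶠ f) → D
      rel : (P : Rel) → Pred (Vec D (arʳ P)) 0ℓ

DecidableModel : ∀ {a b} {S : Signature a b} {D : Set} → Model S D → Set b
DecidableModel M = ∀ P → Decidable (Model.rel M P)

infixr 5 _∙_

_∙_ : ∀ {D : Set} → D → (ℕ → D) → (ℕ → D)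
(d ∙ ρ) zero    = d
(d ∙ ρ) (suc n) = ρ n

module _ {a b} {S : Signature a b} {D : Set} (M : Model S D) where
  open Model M

  mutual
    eval : (ℕ → D) → Term S → D
    eval ρ (var n)    = ρ n
    eval ρ (app f ts) = fun f (evals ρ ts)

    -- map (eval ρ), inlined so that the termination checker accepts eval.
    evals : ∀ {n} → (ℕ → D) → Vec (Term S) n → Vec D n
    evals ρ []       = []
    evals ρ (t ∷ ts) = eval ρ t ∷ evals ρ ts

infix 3 _⊨[_]_

_⊨[_]_ : ∀ {a b} {S : Signature a b} {D : Set} → Model S D → (ℕ → D) → Formula S → Set
M ⊨[ ρ ] ⊥̇         = ⊥
M ⊨[ ρ ] atom P ts = Model.rel M P (evals M ρ ts)
M ⊨[ ρ ] (φ →̇ ψ)   = M ⊨[ ρ ] φ → M ⊨[ ρ ] ψ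
M ⊨[ ρ ] (φ ∧̇ ψ)   = (M ⊨[ ρ ] φ) × (M ⊨[ ρ ] ψ)
M ⊨[ ρ ] (φ ∨̇ ψ)   = (M ⊨[ ρ ] φ) ⊎ (M ⊨[ ρ ] ψ)
M ⊨[ ρ ] (∀̇ φ)     = ∀ d → M ⊨[ d ∙ ρ ] φ
M ⊨[ ρ ] (∃̇ φ)     = ∃[ d ] (M ⊨[ d ∙ ρ ] φ)

FSAT : ∀ {a b} (S : Signature a b) → Pred (Formula S) (a ⊔ b ⊔ lsuc 0ℓ)
FSAT S φ =
  Σ[ D ∈ Set ] Σ[ M ∈ Model S D ] Σ[ ρ ∈ (ℕ → D) ]
    Finite D × DecidableModel M × (M ⊨[ ρ ] φ)

module Submission where

-- A formula over S is interpreted in a directed graph whose nodes all act as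
-- elements of the domain; this needs no relativised quantifiers, because without
-- equality a domain may contain copies of its elements. A tuple (s; x₁,…,xₙ) is
-- coded by a node e with an edge to a label of s, such that for each i some looped
-- node p has edges to e and to a label of i and receives an edge from xᵢ. Only the
-- looped successors of xᵢ matter here, so nodes with the same looped successors are
-- indistinguishable, and totality and functionality of a function symbol f are
-- first-order conditions, with a node coding (f; x₁,…,xₙ)
-- serving as the value. Any graph satisfying these conditions for the finitely many
-- symbols of φ therefore yields a structure for S on the same nodes. Conversely, a
-- finite structure on D yields a graph on D × Role in which the nodes (a , position i)
-- are looped. Finiteness, being a listing, makes D discrete, so edges are decidable.

open import Defs
open import Data.Empty using (⊥)
open import Data.Fin using (Fin; zero; suc; toℕ; inject≤)
open import Data.Fin.Properties using (all?; any?; toℕ-injective; toℕ-inject≤)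
import Data.Fin.Properties as Fin
open import Data.List using (List; []; _∷_; _++_; map; allFin; concatMap; length)
open import Data.List using (cartesianProduct; cartesianProductWith)
import Data.List as List
open import Data.List.Extrema.Nat using (max; xs≤max)
import Data.List.Membership.DecPropositional as DecMembership
open import Data.List.Membership.Propositional using (_∈_; find; lose)
open import Data.List.Membership.Propositional.Properties using (∈-++⁺ˡ; ∈-++⁺ʳ; ∈-map⁺; ∈-concatMap⁺)
open import Data.List.Membership.Propositional.Properties using (∈-allFin; ∈-lookup)
open import Data.List.Membership.Propositional.Properties using (∈-cartesianProduct⁺; ∈-cartesianProductWith⁺)
open import Data.List.Relation.Binary.Subset.Propositional using (_⊆_)
import Data.List.Relation.Unary.All as All
open import Data.List.Relation.Unary.Any using (here; there)
import Data.List.Relation.Unary.Any as Any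
open import Data.List.Relation.Unary.Any.Properties using (lookup-index)
open import Data.Nat using (ℕ; zero; suc; _+_; _≤_)
import Data.Nat.Properties as ℕ
open import Data.Product using (∃-syntax; _×_; _,_; proj₁; proj₂)
open import Data.Product.Function.NonDependent.Propositional using (_×-⇔_)
open import Data.Sum using (_⊎_; inj₁; inj₂; [_,_]′)
open import Data.Sum.Function.Propositional using (_⊎-⇔_)
import Data.Sum.Properties as Sum
open import Data.Unit using (tt)
import Data.Vec as Vec
open import Data.Vec using (Vec; []; _∷_; lookup; tabulate)
open import Data.Vec.Properties using (lookup-map; lookup∘tabulate; tabulate∘lookup; tabulate-cong)
open import Function using (_∘_; id)
open import Function.Bundles using (_⇔_; mk⇔; Equivalence)
open import Function.Properties.Equivalence using () renaming (refl to ⇔-refl; trans to ⇔-trans)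
open import Function.Related.TypeIsomorphisms using (→-cong-⇔)
open import Level using (_⊔_)
open import Relation.Binary.Definitions using (DecidableEquality)
open import Relation.Binary.PropositionalEquality using (_≡_; refl; sym; trans; cong; subst)
open import Relation.Nullary using (Dec; yes; no; contradiction; map′; _×-dec_)
open import Relation.Unary using (Pred; Decidable)

open Equivalence using (to; from)

-- Equivalences under quantifiers.

module _ {a p q} {A : Set a} {P : A → Set p} {Q : A → Set q} where

  ∃-⇔ : (∀ x → P x ⇔ Q x) → (∃[ x ] P x) ⇔ (∃[ x ] Q x)
  ∃-⇔ e = mk⇔ (λ (x , p) → x , to (e x) p) (λ (x , q) → x , from (e x) q)

  ∀-⇔ : (∀ x → P x ⇔ Q x) → (∀ x → P x) ⇔ (∀ x → Q x)
  ∀-⇔ e = mk⇔ (λ p x → to (e x) (p x)) (λ q x → from (e x) (q x))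

  -- Serves with `R` as the loop condition: predicates on nodes are compared only at position nodes.
  ∩-⇔ : ∀ {r} {R : A → Set r} → (∀ x → R x → P x ⇔ Q x) → ∀ x → (R x × P x) ⇔ (R x × Q x)
  ∩-⇔ e x = mk⇔ (λ (r , p) → r , to (e x r) p) (λ (r , q) → r , from (e x r) q)

-- Formulas that code tuples in a graph.

Formula₂ : Set
Formula₂ = Formula binarySignature

Model₂ : Set → Set₁
Model₂ = Model binarySignature

infix 7 _⟶_
_⟶_ : ℕ → ℕ → Formula₂
x ⟶ y = atom tt (var x ∷ var y ∷ [])

⊤̇ : Formula₂
⊤̇ = ⊥̇ →̇ ⊥̇

components : ∀ {n} → (ℕ → ℕ) → ℕ → Vec Formula₂ n → Formula₂
components pos e []       = ⊤̇
components pos e (A ∷ As) =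
  (∃̇ (0 ⟶ 0 ∧̇ 0 ⟶ suc (pos 0) ∧̇ 0 ⟶ suc e ∧̇ A)) ∧̇ components (pos ∘ suc) e As

-- The formulas describing the components see the position node as 0 and the
-- tuple node as 1.
tuple : ∀ {n} → ℕ → (ℕ → ℕ) → Vec Formula₂ n → Formula₂
tuple s pos As = 0 ⟶ s ∧̇ components pos 0 As

-- The new quantifier goes innermost, since `d ∙ extend (lookup v) ρ` is definitionally
-- `extend (lookup (d ∷ v)) ρ`.
∀̇^ : ℕ → Formula₂ → Formula₂
∀̇^ zero    φ = φ
∀̇^ (suc n) φ = ∀̇^ n (∀̇ φ)

⋀ : List Formula₂ → Formula₂
⋀ []       = ⊤̇
⋀ (φ ∷ φs) = φ ∧̇ ⋀ φs

extend : ∀ {A : Set} {n} → (Fin n → A) → (ℕ → A) → (ℕ → A)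
extend {n = zero}  g ρ = ρ
extend {n = suc n} g ρ = g zero ∙ extend (g ∘ suc) ρ

module _ {A : Set} where

  extend-toℕ : ∀ {n} (g : Fin n → A) ρ i → extend g ρ (toℕ i) ≡ g i
  extend-toℕ g ρ zero    = refl
  extend-toℕ g ρ (suc i) = extend-toℕ (g ∘ suc) ρ i

  extend-+ : ∀ {n} (g : Fin n → A) ρ k → extend g ρ (n + k) ≡ ρ k
  extend-+ {zero}  g ρ k = refl
  extend-+ {suc n} g ρ k = extend-+ (g ∘ suc) ρ k

-- Semantics of the tuple formulas.

module BinarySemantics {E : Set} (B : Model₂ E) where

  P : E → E → Set
  P x y = Model.rel B tt (x ∷ y ∷ [])

  Component : E → E → (E → Set) → Set
  Component l e Q = ∃[ p ] P p p × P p l × P p e × Q p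

  -- A component enters as a predicate on position nodes, not as an element, so one notion serves
  -- nodes, values of terms and elements of a structure.
  Codes : ∀ {n} → E → (ℕ → E) → (Fin n → E → Set) → E → Set
  Codes s pos Q e = P e s × (∀ i → Component (pos (toℕ i)) e (Q i))

  Component-⇔ : ∀ {Q Q′ : E → Set} {l l′} → l ≡ l′ → ∀ e → (∀ p → P p p → Q p ⇔ Q′ p) →
                Component l e Q ⇔ Component l′ e Q′
  Component-⇔ refl e h =
    ∃-⇔ (∩-⇔ λ p pp → ⇔-refl ×-⇔ ⇔-refl ×-⇔ h p pp)

  Codes-⇔ : ∀ {n} {Q Q′ : Fin n → E → Set} {s s′} pos pos′ → s ≡ s′ →
            (∀ i → pos (toℕ i) ≡ pos′ (toℕ i)) → (∀ i p → P p p → Q i p ⇔ Q′ i p) →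
            ∀ e → Codes s pos Q e ⇔ Codes s′ pos′ Q′ e
  Codes-⇔ _ _ refl eq h e = ⇔-refl ×-⇔ ∀-⇔ λ i → Component-⇔ (eq i) e (h i)

  ⊨-components : ∀ {n} ρ pos e (As : Vec Formula₂ n) →
    (B ⊨[ ρ ] components pos e As) ⇔
    (∀ i → Component (ρ (pos (toℕ i))) (ρ e) (λ p → B ⊨[ p ∙ ρ ] lookup As i))
  ⊨-components ρ pos e []       = mk⇔ (λ _ ()) (λ _ ())
  ⊨-components ρ pos e (A ∷ As) = mk⇔
    (λ { (c , cs) zero → c ; (c , cs) (suc i) → to rest cs i })
    (λ cs → cs zero , from rest (cs ∘ suc))
    where rest = ⊨-components ρ (pos ∘ suc) e As

  ⊨-tuple : ∀ {n} ρ s pos (As : Vec Formula₂ n) →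
    (B ⊨[ ρ ] tuple s pos As) ⇔
    Codes (ρ s) (ρ ∘ pos) (λ i p → B ⊨[ p ∙ ρ ] lookup As i) (ρ 0)
  ⊨-tuple ρ s pos As = ⇔-refl ×-⇔ ⊨-components ρ pos 0 As

  ⊨-∀̇^ : ∀ n {ρ φ} → (B ⊨[ ρ ] ∀̇^ n φ) ⇔ (∀ (v : Vec E n) → B ⊨[ extend (lookup v) ρ ] φ)
  ⊨-∀̇^ zero    = mk⇔ (λ h → λ { [] → h }) (λ h → h [])
  ⊨-∀̇^ (suc n) = ⇔-trans (⊨-∀̇^ n) (mk⇔ (λ h → λ { (d ∷ v) → h v d }) (λ h v d → h (d ∷ v)))

  ⊨-⋀ : ∀ {a} {A : Set a} {ρ} (F : A → Formula₂) xs →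
        (B ⊨[ ρ ] ⋀ (map F xs)) ⇔ (∀ {x} → x ∈ xs → B ⊨[ ρ ] F x)
  ⊨-⋀ F []       = mk⇔ (λ _ ()) (λ _ ())
  ⊨-⋀ F (x ∷ xs) = mk⇔
    (λ { (h , hs) (here refl) → h ; (h , hs) (there m) → to (⊨-⋀ F xs) hs m })
    (λ h → h (here refl) , from (⊨-⋀ F xs) (λ m → h (there m)))

-- Finite types: decidable equality, search, listing of vectors.

module _ {A : Set} (finite : Finite A) where

  private
    elements  = proj₁ finite
    complete  = proj₂ finite
    position  = λ x → Any.index (complete x)

  -- Looking up the chosen position of an element returns the element, so comparing positions
  -- suffices, even if entries repeat.
  finite⇒≟ : DecidableEquality A
  finite⇒≟ x y = map′ position-injective (cong position) (position x Fin.≟ position y)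
    where
    position-injective : position x ≡ position y → x ≡ y
    position-injective eq =
      trans (lookup-index (complete x))
        (trans (cong (List.lookup elements) eq) (sym (lookup-index (complete y))))

  finite⇒∃? : ∀ {p} {P : Pred A p} → Decidable P → Dec (∃[ x ] P x)
  finite⇒∃? P? = map′ (λ any → let x , _ , px = find any in x , px)
                      (λ (x , px) → lose (complete x) px)
                      (Any.any? P? elements)

  vectors : ∀ n → List (Vec A n)
  vectors zero    = [] ∷ []
  vectors (suc n) = cartesianProductWith _∷_ elements (vectors n)

  ∈-vectors : ∀ {n} (v : Vec A n) → v ∈ vectors n
  ∈-vectors []      = here refl
  ∈-vectors (x ∷ v) = ∈-cartesianProductWith⁺ _∷_ (complete x) (∈-vectors v)

lookup-injective : ∀ {A : Set} {n} (v w : Vec A n) → (∀ i → lookup v i ≡ lookup w i) → v ≡ w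
lookup-injective v w h =
  trans (sym (tabulate∘lookup v)) (trans (tabulate-cong h) (tabulate∘lookup w))

-- Translation of formulas.

record Names {c} (Symbol : Set c) : Set c where
  field
    src : ℕ → ℕ
    pos : ℕ → ℕ
    tag : Symbol → ℕ

open Names

module _ {c} {Symbol : Set c} where

  -- Passes an auxiliary quantifier, whereas `bind` passes the image of a source quantifier, whose
  -- variable becomes source variable 0.
  weaken : Names Symbol → Names Symbol
  weaken η = record { src = suc ∘ src η ; pos = suc ∘ pos η ; tag = suc ∘ tag η }

  bind : Names Symbol → Names Symbol
  bind η = record { src = 0 ∙ (suc ∘ src η) ; pos = suc ∘ pos η ; tag = suc ∘ tag η }

module Translation {a b} (S : Signature a b) where
  open Signature S

  Symbol : Set (a ⊔ b)
  Symbol = Fun ⊎ Rel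

  arity : Symbol → ℕ
  arity = [ arᶠ , arʳ ]′

  mutual
    symbolsᵗ : Term S → List Symbol
    symbolsᵗ (var n)    = []
    symbolsᵗ (app f ts) = inj₁ f ∷ symbolsᵗˢ ts

    symbolsᵗˢ : ∀ {n} → Vec (Term S) n → List Symbol
    symbolsᵗˢ []       = []
    symbolsᵗˢ (t ∷ ts) = symbolsᵗ t ++ symbolsᵗˢ ts

  symbols : Formula S → List Symbol
  symbols ⊥̇           = []
  symbols (atom R ts) = inj₂ R ∷ symbolsᵗˢ ts
  symbols (φ →̇ ψ)     = symbols φ ++ symbols ψ
  symbols (φ ∧̇ ψ)     = symbols φ ++ symbols ψ
  symbols (φ ∨̇ ψ)     = symbols φ ++ symbols ψ
  symbols (∀̇ φ)       = symbols φ
  symbols (∃̇ φ)       = symbols φ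

  -- points η t says that the value of t has an edge to the position node 0. The
  -- node coding f(t₁,…,tₙ) is itself used as the value of this term.
  mutual
    points : Names Symbol → Term S → Formula₂
    points η (var n)    = src η n ⟶ 0
    points η (app f ts) =
      ∃̇ (tuple (suc (tag η (inj₁ f))) (suc ∘ pos η) (pointss (weaken (weaken η)) ts) ∧̇ 0 ⟶ 1)

    pointss : ∀ {n} → Names Symbol → Vec (Term S) n → Vec Formula₂ n
    pointss η []       = []
    pointss η (t ∷ ts) = points η t ∷ pointss η ts

  translate : Names Symbol → Formula S → Formula₂
  translate η ⊥̇           = ⊥̇
  translate η (atom R ts) =
    ∃̇ tuple (suc (tag η (inj₂ R))) (suc ∘ pos η) (pointss (weaken (weaken η)) ts)
  translate η (φ →̇ ψ)     = translate η φ →̇ translate η ψ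
  translate η (φ ∧̇ ψ)     = translate η φ ∧̇ translate η ψ
  translate η (φ ∨̇ ψ)     = translate η φ ∨̇ translate η ψ
  translate η (∀̇ φ)       = ∀̇ translate (bind η) φ
  translate η (∃̇ φ)       = ∃̇ translate (bind η) φ

  -- `k` variables, the tuple node included, are bound inside the block of `arity s` argument
  -- variables; the extra `suc` skips the position node.
  variableTuple : Names Symbol → Symbol → ℕ → Formula₂
  variableTuple η s k = tuple (k + (arity s + tag η s)) (λ i → k + (arity s + pos η i))
                              (tabulate {n = arity s} λ i → suc (k + toℕ i) ⟶ 0)

  -- Without equality, uniqueness can only say that the nodes coding a tuple have
  -- the same edges to position nodes, which are those with a loop.
  functional : Names Symbol → Symbol → Formula₂
  functional η (inj₁ f) = ∀̇^ (arᶠ f)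
    (∃̇ (variableTuple η (inj₁ f) 1 ∧̇
        (∀̇ (variableTuple η (inj₁ f) 2 →̇ (∀̇ (0 ⟶ 0 →̇ 1 ⟶ 0 →̇ 2 ⟶ 0))))))
  functional η (inj₂ R) = ⊤̇

  module _ {E : Set} (B : Model₂ E) where
    open BinarySemantics B

    ⊨-variableTuple : ∀ {ρ σ} η s k (v : Vec E (arity s)) →
      (∀ i → ρ (k + toℕ i) ≡ lookup v i) → (∀ x → ρ (k + (arity s + x)) ≡ σ x) →
      (B ⊨[ ρ ] variableTuple η s k) ⇔ Codes (σ (tag η s)) (σ ∘ pos η) (λ i → P (lookup v i)) (ρ 0)
    ⊨-variableTuple {ρ} {σ} η s k v hv hσ =
      ⇔-trans
        (⊨-tuple ρ (k + (arity s + tag η s)) (λ i → k + (arity s + pos η i)) (tabulate F))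
        (Codes-⇔ (λ i → ρ (k + (arity s + pos η i))) (σ ∘ pos η)
          (hσ (tag η s)) (λ i → hσ (pos η (toℕ i))) component (ρ 0))
      where
      F : Fin (arity s) → Formula₂
      F i = suc (k + toℕ i) ⟶ 0

      component : ∀ i p → P p p → (B ⊨[ p ∙ ρ ] lookup (tabulate F) i) ⇔ P (lookup v i) p
      component i p _ rewrite lookup∘tabulate F i | hv i = ⇔-refl

    -- One inclusion suffices: `e` is itself a code, so the position nodes with an edge from some
    -- code are exactly those with an edge from `e`.
    Functional : ∀ n → E → (ℕ → E) → Set
    Functional n t pos = ∀ (v : Vec E n) →
      let C = Codes t pos (λ i → P (lookup v i)) in
      ∃[ e ] C e × (∀ e′ → C e′ → ∀ p → P p p → P e′ p → P e p)

    ⊨-functional : ∀ {σ} η f → (B ⊨[ σ ] functional η (inj₁ f)) ⇔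
                   Functional (arᶠ f) (σ (tag η (inj₁ f))) (σ ∘ pos η)
    ⊨-functional {σ} η f =
      ⇔-trans (⊨-∀̇^ (arᶠ f)) (∀-⇔ λ v →
        let g = extend (lookup v) σ
            hv = extend-toℕ (lookup v) σ
            hσ = extend-+ (lookup v) σ
        in ∃-⇔ λ e →
          ⊨-variableTuple {e ∙ g} η (inj₁ f) 1 v hv hσ ×-⇔
          (∀-⇔ λ e′ → →-cong-⇔ (⊨-variableTuple {e′ ∙ e ∙ g} η (inj₁ f) 2 v hv hσ) ⇔-refl))

  -- Correctness of the translation when nodes represent elements of a structure.

  module Simulation {D E : Set} (M : Model S D) (B : Model₂ E)
           (r : E → D) (r-surjective : ∀ d → ∃[ x ] r x ≡ d)
           (Q : D → E → Set)
           (edges : ∀ x p → BinarySemantics.P B p p → BinarySemantics.P B x p ⇔ Q (r x) p) where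
    open Model M
    open BinarySemantics B

    -- A code of a function tuple need not represent `fun f v`: only the position nodes reached are
    -- compared.
    record Simulates (L : List Symbol) (tagE : Symbol → E) (posE : ℕ → E) : Set (a ⊔ b) where
      field
        funs : ∀ f → inj₁ f ∈ L → ∀ v p → P p p →
               (∃[ e ] Codes (tagE (inj₁ f)) posE (λ i → Q (lookup v i)) e × P e p) ⇔ Q (fun f v) p
        rels : ∀ R → inj₂ R ∈ L → ∀ v →
               (∃[ e ] Codes (tagE (inj₂ R)) posE (λ i → Q (lookup v i)) e) ⇔ rel R v

    open Simulates

    module _ {L : List Symbol} where

      mutual
        -- `edges` speaks of looped targets only, hence the assumed loop at `σ 0`; `Component`
        -- supplies the loop at each nested position node.
        ⊨-points : ∀ {ρ σ} η → Simulates L (σ ∘ tag η) (σ ∘ pos η) →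
                   (∀ n → r (σ (src η n)) ≡ ρ n) → ∀ t → symbolsᵗ t ⊆ L →
                   P (σ 0) (σ 0) → (B ⊨[ σ ] points η t) ⇔ Q (eval M ρ t) (σ 0)
        ⊨-points {ρ} {σ} η sim h (var n)    ss pp =
          subst (λ d → P (σ (src η n)) (σ 0) ⇔ Q d (σ 0)) (h n) (edges _ _ pp)
        ⊨-points {ρ} {σ} η sim h (app f ts) ss pp =
          ⇔-trans
            (∃-⇔ λ e → ⊨-pointss-tuple η sim h ts (ss ∘ there) (inj₁ f) e ×-⇔ ⇔-refl)
            (funs sim f (ss (here refl)) (evals M ρ ts) (σ 0) pp)

        ⊨-pointss : ∀ {ρ σ} η → Simulates L (σ ∘ tag η) (σ ∘ pos η) →
                    (∀ n → r (σ (src η n)) ≡ ρ n) → ∀ {n} (ts : Vec (Term S) n) → symbolsᵗˢ ts ⊆ L →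
                    P (σ 0) (σ 0) → ∀ i →
                    (B ⊨[ σ ] lookup (pointss η ts) i) ⇔ Q (lookup (evals M ρ ts) i) (σ 0)
        ⊨-pointss η sim h (t ∷ ts) ss pp zero    =
          ⊨-points η sim h t (ss ∘ ∈-++⁺ˡ) pp
        ⊨-pointss η sim h (t ∷ ts) ss pp (suc i) =
          ⊨-pointss η sim h ts (ss ∘ ∈-++⁺ʳ (symbolsᵗ t)) pp i

        ⊨-pointss-tuple : ∀ {ρ σ} η → Simulates L (σ ∘ tag η) (σ ∘ pos η) →
          (∀ n → r (σ (src η n)) ≡ ρ n) → ∀ {n} (ts : Vec (Term S) n) → symbolsᵗˢ ts ⊆ L → ∀ s e →
          (B ⊨[ e ∙ σ ] tuple (suc (tag η s)) (suc ∘ pos η) (pointss (weaken (weaken η)) ts)) ⇔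
          Codes (σ (tag η s)) (σ ∘ pos η) (λ i → Q (lookup (evals M ρ ts) i)) e
        ⊨-pointss-tuple {ρ} {σ} η sim h ts ss s e =
          ⇔-trans
            (⊨-tuple (e ∙ σ) (suc (tag η s)) (suc ∘ pos η) (pointss (weaken (weaken η)) ts))
            (Codes-⇔ (σ ∘ pos η) (σ ∘ pos η) refl (λ _ → refl)
              -- The twice weakened names at `p ∙ e ∙ σ` compute to `η` at `σ`, so `sim` and `h`
              -- carry over.
              (λ i p pp → ⊨-pointss {ρ} {p ∙ e ∙ σ} (weaken (weaken η)) sim h ts ss pp i) e)

      extend-source : ∀ {ρ : ℕ → D} {σ} (η : Names Symbol) {d e} → r e ≡ d →
                      (∀ n → r (σ (src η n)) ≡ ρ n) → ∀ n →
                      r ((e ∙ σ) (src (bind η) n)) ≡ (d ∙ ρ) n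
      extend-source η eq h zero    = eq
      extend-source η eq h (suc n) = h n

      ⊨-translate : ∀ {ρ σ} η → Simulates L (σ ∘ tag η) (σ ∘ pos η) →
                    (∀ n → r (σ (src η n)) ≡ ρ n) → ∀ φ → symbols φ ⊆ L →
                    (B ⊨[ σ ] translate η φ) ⇔ (M ⊨[ ρ ] φ)
      ⊨-translate η sim h ⊥̇ ss = ⇔-refl
      ⊨-translate {ρ} η sim h (atom R ts) ss =
        ⇔-trans
          (∃-⇔ (⊨-pointss-tuple η sim h ts (ss ∘ there) (inj₂ R)))
          (rels sim R (ss (here refl)) (evals M ρ ts))
      ⊨-translate η sim h (φ →̇ ψ) ss =
        →-cong-⇔ (⊨-translate η sim h φ (ss ∘ ∈-++⁺ˡ))
                 (⊨-translate η sim h ψ (ss ∘ ∈-++⁺ʳ (symbols φ)))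
      ⊨-translate η sim h (φ ∧̇ ψ) ss =
        ⊨-translate η sim h φ (ss ∘ ∈-++⁺ˡ) ×-⇔ ⊨-translate η sim h ψ (ss ∘ ∈-++⁺ʳ (symbols φ))
      ⊨-translate η sim h (φ ∨̇ ψ) ss =
        ⊨-translate η sim h φ (ss ∘ ∈-++⁺ˡ) ⊎-⇔ ⊨-translate η sim h ψ (ss ∘ ∈-++⁺ʳ (symbols φ))
      ⊨-translate {ρ} {σ} η sim h (∀̇ φ) ss = mk⇔
        -- Since `r` is surjective, a quantifier over nodes reaches every `d`.
        (λ g d → let x , eq = r-surjective d in
          to (⊨-translate {d ∙ ρ} {x ∙ σ} (bind η) sim (extend-source η eq h) φ ss) (g x))
        (λ g x →
          from (⊨-translate {r x ∙ ρ} {x ∙ σ} (bind η) sim (extend-source η refl h) φ ss) (g (r x)))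
      ⊨-translate {ρ} {σ} η sim h (∃̇ φ) ss = mk⇔
        (λ (x , g) → r x ,
          to (⊨-translate {r x ∙ ρ} {x ∙ σ} (bind η) sim (extend-source η refl h) φ ss) g)
        (λ (d , g) → let x , eq = r-surjective d in x ,
          from (⊨-translate {d ∙ ρ} {x ∙ σ} (bind η) sim (extend-source η eq h) φ ss) g)

  -- From a finite graph to a structure on its nodes.

  module Decoding {E : Set} (B : Model₂ E) (σ : ℕ → E) (finite : Finite E) (B? : DecidableModel B)
                  (L : List Symbol) (_∈L? : ∀ s → Dec (s ∈ L)) (η : Names Symbol)
                  (axioms : B ⊨[ σ ] ⋀ (map (functional η) L)) where
    open BinarySemantics B

    CodesAt : ∀ s → Vec E (arity s) → E → Set
    CodesAt s v = Codes (σ (tag η s)) (σ ∘ pos η) (λ i → P (lookup v i))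

    CodesAt? : ∀ s v → Decidable (CodesAt s v)
    CodesAt? s v e = P? e (σ (tag η s)) ×-dec all? λ i → finite⇒∃? finite λ p →
      P? p p ×-dec P? p (σ (pos η (toℕ i))) ×-dec P? p e ×-dec P? (lookup v i) p
      where
      P? : ∀ x y → Dec (P x y)
      P? x y = B? tt (x ∷ y ∷ [])

    isFunctional : ∀ f → inj₁ f ∈ L → Functional B (arᶠ f) (σ (tag η (inj₁ f))) (σ ∘ pos η)
    isFunctional f m = to (⊨-functional B η f) (to (⊨-⋀ (functional η) L) axioms m)

    function : ∀ f → Dec (inj₁ f ∈ L) → Vec E (arᶠ f) → E
    function f (yes m) v = proj₁ (isFunctional f m v)
    -- Default for symbols outside `L`, which do not occur in the decoded formula.
    function f (no _)  v = σ 0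

    M : Model S E
    M = record
      { fun = λ f → function f (inj₁ f ∈L?)
      ; rel = λ R v → ∃[ e ] CodesAt (inj₂ R) v e
      }

    M? : DecidableModel M
    M? R v = finite⇒∃? finite (CodesAt? (inj₂ R) v)

    open Simulation M B id (λ d → d , refl) P (λ _ _ _ → ⇔-refl)

    simulates : Simulates L (σ ∘ tag η) (σ ∘ pos η)
    simulates = record { funs = funs′ ; rels = λ _ _ _ → ⇔-refl }
      where
      funs′ : ∀ f → inj₁ f ∈ L → ∀ v p → P p p →
              (∃[ e ] CodesAt (inj₁ f) v e × P e p) ⇔ P (Model.fun M f v) p
      funs′ f m v p pp with inj₁ f ∈L?
      ... | no m∉   = contradiction m m∉
      ... | yes m∈ = let e , ce , unique = isFunctional f m∈ v in
        mk⇔ (λ (e′ , ce′ , e′p) → unique e′ ce′ p pp e′p) (λ ep → e , ce , ep)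

    decode : ∀ φ → symbols φ ⊆ L → B ⊨[ σ ] translate η φ → M ⊨[ σ ∘ src η ] φ
    decode φ ss = to (⊨-translate η simulates (λ _ → refl) φ ss)

  -- From a finite structure to a graph.

  module FreeNames (L : List Symbol) (_∈L? : ∀ s → Dec (s ∈ L)) where

    -- Positive, so that there is always some position.
    width : ℕ
    width = suc (max 0 (map arity L))

    indexOf : ∀ s → Dec (s ∈ L) → ℕ
    indexOf s (yes m) = toℕ (Any.index m)
    indexOf s (no _)  = 0

    -- Three blocks of free variables: `width` position labels, one label per entry of `L`, then the
    -- source variables.
    names : Names Symbol
    names = record
      { src = λ n → width + (length L + n)
      ; pos = id
      ; tag = λ s → width + indexOf s (s ∈L?)
      }

  -- An edge is read according to the role of its target, so that the element and
  -- the role of a node cannot be confused; exactly the position nodes carry loops.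
  module Encoding {D : Set} (M : Model S D) (finite : Finite D) (M? : DecidableModel M)
                  (ρ : ℕ → D) (L : List Symbol) (_∈L? : ∀ s → Dec (s ∈ L)) where
    open Model M
    open FreeNames L _∈L?

    Tag : Set
    Tag = Fin (length L)

    symbolAt : Tag → Symbol
    symbolAt = List.lookup L

    arity≤width : ∀ j → arity (symbolAt j) ≤ width
    arity≤width j = ℕ.m≤n⇒m≤1+n (All.lookup (xs≤max 0 (map arity L)) (∈-map⁺ arity (∈-lookup j)))

    data Role : Set where
      position positionLabel : Fin width → Role
      tagLabel               : Tag → Role
      code                   : ∀ j → Vec D (arity (symbolAt j)) → Role

    Node : Set
    Node = D × Role

    -- Guards the edge from `(d , code j v)` to the label of `j`: a function symbol admits only its
    -- value as `d`, a true relation any `d`.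
    Holds : ∀ s → Vec D (arity s) → D → Set
    Holds (inj₁ f) v d = fun f v ≡ d
    Holds (inj₂ R) v d = rel R v

    Holds? : ∀ s v d → Dec (Holds s v d)
    Holds? (inj₁ f) v d = finite⇒≟ finite (fun f v) d
    Holds? (inj₂ R) v d = M? R v

    -- Every node points to the position nodes with its own element, and so acts as that element.
    -- `Fin width` and the indices of `v` differ in bound, hence the comparison by `toℕ`.
    Edge : Node → Node → Set
    Edge x                  (d , position i)      = proj₁ x ≡ d
    Edge (a , position i)   (d , code j v)        = ∃[ k ] toℕ k ≡ toℕ i × lookup v k ≡ a
    Edge (a , position i)   (d , positionLabel k) = i ≡ k
    Edge (a , code j v)     (d , tagLabel k)      = j ≡ k × Holds (symbolAt j) v a
    Edge _                  _                     = ⊥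

    Edge? : ∀ x y → Dec (Edge x y)
    Edge? x                  (d , position i)      = finite⇒≟ finite (proj₁ x) d
    Edge? (a , position i)   (d , code j v)        =
      any? λ k → toℕ k ℕ.≟ toℕ i ×-dec finite⇒≟ finite (lookup v k) a
    Edge? (a , position i)   (d , positionLabel k) = i Fin.≟ k
    Edge? (a , code j v)     (d , tagLabel k)      = j Fin.≟ k ×-dec Holds? (symbolAt j) v a
    Edge? (a , positionLabel _) (d , positionLabel _) = no λ ()
    Edge? (a , tagLabel _)      (d , positionLabel _) = no λ ()
    Edge? (a , code _ _)        (d , positionLabel _) = no λ ()
    Edge? (a , position _)      (d , tagLabel _)      = no λ ()
    Edge? (a , positionLabel _) (d , tagLabel _)      = no λ ()
    Edge? (a , tagLabel _)      (d , tagLabel _)      = no λ ()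
    Edge? (a , positionLabel _) (d , code _ _)        = no λ ()
    Edge? (a , tagLabel _)      (d , code _ _)        = no λ ()
    Edge? (a , code _ _)        (d , code _ _)        = no λ ()

    roles : List Role
    roles = map position (allFin width) ++ map positionLabel (allFin width) ++
            map tagLabel (allFin _) ++
            concatMap (λ j → map (code j) (vectors finite (arity (symbolAt j)))) (allFin _)

    ∈-roles : ∀ ρ → ρ ∈ roles
    ∈-roles (position i)      = ∈-++⁺ˡ (∈-map⁺ position (∈-allFin i))
    ∈-roles (positionLabel i) =
      ∈-++⁺ʳ (map position (allFin width)) (∈-++⁺ˡ (∈-map⁺ positionLabel (∈-allFin i)))
    ∈-roles (tagLabel j)      =
      ∈-++⁺ʳ (map position (allFin width)) (∈-++⁺ʳ (map positionLabel (allFin width))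
        (∈-++⁺ˡ (∈-map⁺ tagLabel (∈-allFin j))))
    ∈-roles (code j v)        =
      ∈-++⁺ʳ (map position (allFin width)) (∈-++⁺ʳ (map positionLabel (allFin width))
        (∈-++⁺ʳ (map tagLabel (allFin _))
          (∈-concatMap⁺ _ (lose (∈-allFin j) (∈-map⁺ (code j) (∈-vectors finite v))))))

    Node-finite : Finite Node
    Node-finite = cartesianProduct (proj₁ finite) roles ,
                  λ (d , ρ) → ∈-cartesianProduct⁺ (proj₂ finite d) (∈-roles ρ)

    B : Model₂ Node
    B = record { fun = λ () ; rel = λ { _ (x ∷ y ∷ []) → Edge x y } }

    B? : DecidableModel B
    B? _ (x ∷ y ∷ []) = Edge? x y

    open BinarySemantics B

    Q : D → Node → Set
    Q d x = d ≡ proj₁ x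

    edges : ∀ x p → P p p → P x p ⇔ Q (proj₁ x) p
    edges x (d , position i) _ = ⇔-refl

    loop-role : ∀ x → P x x → ∃[ i ] proj₂ x ≡ position i
    loop-role (d , position i) _ = i , refl

    -- Edges into a label node do not depend on its element, so `ρ 0` is an arbitrary choice; a
    -- source variable may likewise take any role.
    tagNodes : ℕ → Node
    tagNodes = extend (λ j → ρ 0 , tagLabel j) (λ n → ρ n , position zero)

    σ : ℕ → Node
    σ = extend (λ i → ρ 0 , positionLabel i) tagNodes

    σ-source : ∀ n → proj₁ (σ (src names n)) ≡ ρ n
    σ-source n = cong proj₁ (trans (extend-+ (λ i → ρ 0 , positionLabel i) tagNodes (length L + n))
                                   (extend-+ (λ j → ρ 0 , tagLabel j) _ n))

    σ-pos : ∀ i → σ (toℕ i) ≡ (ρ 0 , positionLabel i)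
    σ-pos = extend-toℕ _ tagNodes

    σ-tag : ∀ s → s ∈ L → ∃[ j ] s ≡ symbolAt j × σ (tag names s) ≡ (ρ 0 , tagLabel j)
    σ-tag s m with s ∈L?
    ... | no m∉   = contradiction m m∉
    ... | yes m∈ = Any.index m∈ , lookup-index m∈ ,
      trans (extend-+ (λ i → ρ 0 , positionLabel i) tagNodes _)
            (extend-toℕ (λ j → ρ 0 , tagLabel j) _ (Any.index m∈))

    CodesAt : ∀ s → Vec D (arity s) → Node → Set
    CodesAt s v = Codes (σ (tag names s)) σ (λ i → Q (lookup v i))

    module _ (j : Tag) (eqʲ : σ (tag names (symbolAt j)) ≡ (ρ 0 , tagLabel j)) where

      private
        place : Fin (arity (symbolAt j)) → Fin width
        place i = inject≤ i (arity≤width j)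

        label : ∀ i → σ (toℕ i) ≡ (ρ 0 , positionLabel (place i))
        label i = trans (cong σ (sym (toℕ-inject≤ i (arity≤width j)))) (σ-pos (place i))

      -- The loop makes `p` a position node, its label fixes the index, its edge to the code equates
      -- its element with an entry of `w`, and `Q` with that of `v`.
      component⇒≡ : ∀ {v w d} i → Component (σ (toℕ i)) (d , code j w) (Q (lookup v i)) →
                    lookup w i ≡ lookup v i
      component⇒≡ i (p , pp , pl , pe , q) with loop-role p pp
      component⇒≡ {v} {w} i ((a , _) , pp , pl , (k , k≡ , wk≡a) , refl) | i′ , refl
        with subst (P _) (label i) pl
      ... | refl = subst (λ k → lookup w k ≡ a)
                         (toℕ-injective (trans k≡ (toℕ-inject≤ i (arity≤width j)))) wk≡a

      -- The edge to the tag label forces the role `code j w` and gives the claim for `w`; the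
      -- components give `w ≡ v`.
      codes⇒holds′ : ∀ {v} e → CodesAt (symbolAt j) v e → Holds (symbolAt j) v (proj₁ e)
      codes⇒holds′ {v} e (h , cs) = by-role e (subst (P e) eqʲ h) cs
        where
        by-role : ∀ e → Edge e (ρ 0 , tagLabel j) →
                  (∀ i → Component (σ (toℕ i)) e (Q (lookup v i))) → Holds (symbolAt j) v (proj₁ e)
        by-role (d , code _ w) (refl , h) cs =
          subst (λ v → Holds (symbolAt j) v d)
                (lookup-injective w v λ i → component⇒≡ {v} {w} {d} i (cs i)) h

      holds⇒codes′ : ∀ {v d} → Holds (symbolAt j) v d → CodesAt (symbolAt j) v (d , code j v)
      holds⇒codes′ {v} {d} h =
        subst (P (d , code j v)) (sym eqʲ) (refl , h) ,
        λ i → (lookup v i , position (place i)) , refl ,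
              subst (P (lookup v i , position (place i))) (sym (label i)) refl ,
              (i , sym (toℕ-inject≤ i (arity≤width j)) , refl) , refl

    codes⇒holds : ∀ s → s ∈ L → ∀ {v} e → CodesAt s v e → Holds s v (proj₁ e)
    codes⇒holds s m e c with σ-tag s m
    ... | j , refl , eq = codes⇒holds′ j eq e c

    holds⇒codes : ∀ s → s ∈ L → ∀ {v d} → Holds s v d → ∃[ x ] CodesAt s v (d , x)
    holds⇒codes s m {v} h with σ-tag s m
    ... | j , refl , eq = code j v , holds⇒codes′ j eq h

    open Simulation M B proj₁ (λ d → (d , position zero) , refl) Q edges

    simulates : Simulates L (σ ∘ tag names) (σ ∘ pos names)
    simulates = record
      { funs = λ f m v p pp → mk⇔
          (λ (e , c , ep) → trans (codes⇒holds (inj₁ f) m e c) (to (edges e p pp) ep))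
          (λ q → let x , c = holds⇒codes (inj₁ f) m {v} refl in
                 (fun f v , x) , c , from (edges _ p pp) q)
      ; rels = λ R m v → mk⇔
          (λ (e , c) → codes⇒holds (inj₂ R) m e c)
          -- Any element may carry the code of a relation tuple; `ρ 0` is at hand.
          (λ h → let x , c = holds⇒codes (inj₂ R) m {v} {ρ 0} h in (ρ 0 , x) , c)
      }

    -- Nodes act through their elements, so `v` is coded like its projection `v′`; every code
    -- carries the element `fun f v′`, hence has the position successors of `e`.
    isFunctional : ∀ f → inj₁ f ∈ L → Functional B (arᶠ f) (σ (tag names (inj₁ f))) (σ ∘ pos names)
    isFunctional f m v = e , from (adjacent e) c , λ e′ c′ p pp e′p →
      from (edges e p pp)
        (trans (codes⇒holds (inj₁ f) m e′ (to (adjacent e′) c′)) (to (edges e′ p pp) e′p))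
      where
      v′ = Vec.map proj₁ v
      e  = fun f v′ , proj₁ (holds⇒codes (inj₁ f) m {v′} refl)
      c  = proj₂ (holds⇒codes (inj₁ f) m {v′} refl)

      adjacent : ∀ e → Codes _ σ (λ i → P (lookup v i)) e ⇔ CodesAt (inj₁ f) v′ e
      adjacent = Codes-⇔ σ σ refl (λ _ → refl) λ i p pp →
        subst (λ d → P (lookup v i) p ⇔ d ≡ proj₁ p) (sym (lookup-map i proj₁ v))
              (edges (lookup v i) p pp)

    axioms : B ⊨[ σ ] ⋀ (map (functional names) L)
    axioms = from (⊨-⋀ (functional names) L) λ {s} → axiom s
      where
      axiom : ∀ s → s ∈ L → B ⊨[ σ ] functional names s
      axiom (inj₁ f) m = from (⊨-functional B names f) (isFunctional f m)
      axiom (inj₂ R) m = id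

    encode : ∀ φ → symbols φ ⊆ L → M ⊨[ ρ ] φ → B ⊨[ σ ] translate names φ
    encode φ ss = from (⊨-translate names simulates σ-source φ ss)

-- The reduction and its two directions.

theorem28 : ∀ {a b} (S : Signature a b) → Discrete S → FSAT S ⪯ FSAT binarySignature
theorem28 S (_≟ᶠ_ , _≟ʳ_) = reduction , λ φ → mk⇔ (encodes φ) (decodes φ)
  where
  open Translation S

  -- Discreteness enters here: the label variable of a symbol is found by locating the symbol in a
  -- list.
  _∈?_ : ∀ s L → Dec (s ∈ L)
  _∈?_ = DecMembership._∈?_ (Sum.≡-dec _≟ᶠ_ _≟ʳ_)

  names : Formula S → Names Symbol
  names φ = FreeNames.names (symbols φ) (_∈? symbols φ)

  reduction : Formula S → Formula₂
  -- The signature may be infinite, so axioms are imposed only for the finitely many symbols of `φ`.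
  reduction φ = ⋀ (map (functional (names φ)) (symbols φ)) ∧̇ translate (names φ) φ

  encodes : ∀ φ → FSAT S φ → FSAT binarySignature (reduction φ)
  encodes φ (D , M , ρ , finite , M? , sat) =
    Node , B , σ , Node-finite , B? , axioms , encode φ id sat
    where
    open Encoding M finite M? ρ (symbols φ) (_∈? symbols φ)

  decodes : ∀ φ → FSAT binarySignature (reduction φ) → FSAT S φ
  decodes φ (E , B , σ , finite , B? , axioms , sat) =
    E , M , σ ∘ src (names φ) , finite , M? , decode φ id sat
    where
    open Decoding B σ finite B? (symbols φ) (_∈? symbols φ) (names φ) axioms
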